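{- A graph $G$ is split if and only if $G$ is almost CIS or $G$ is $\cap$-edge simplicial.
   Context: All graphs are finite and simple; $\overline{G}$ denotes the complement of $G$. A graph $G=(V,E)$ is split if $V$ can be partitioned into a clique $C$ and a stable set $S$ (with $C\cap S=\emptyset$, $C\cup S=V$). A graph $G$ is almost CIS if every maximal clique $C$ and every maximal stable set $S$ of $G$ intersect, except for exactly one pair $(C_0,S_0)$ with $C_0\cap S_0=\emptyset$. A clique $K$ of $G$ is simplicial if $K=N[v]$ for some vertex $v$ (where $N[v]$ is the closed neighborhood of $v$). A graph is edge simplicial if every edge is contained in a simplicial clique. A graph $G$ is $\cap$-edge simplicial if both $G$ and $\overline{G}$ are edge simplicial. -}

module Defs where

open import Data.Nat using (ℕ)
open import Data.Fin using (Fin; _≟_)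
open import Data.Fin.Subset using (Subset; _∈_; _∉_; _⊆_)
open import Data.Bool using (Bool; true; false; not; _∧_; _∨_)
open import Data.Vec using (tabulate)
open import Data.Product using (Σ; _×_; ∃; ∃-syntax)
open import Data.Sum using (_⊎_)
open import Relation.Nullary using (¬_)
open import Relation.Nullary.Decidable using (⌊_⌋)
open import Relation.Binary.PropositionalEquality using (_≡_; _≢_)

record Graph (n : ℕ) : Set where
  field
    adj    : Fin n → Fin n → Bool
    adj-sym    : ∀ u v → adj u v ≡ adj v u
    adj-irrefl : ∀ v → adj v v ≡ false
open Graph public

open import Relation.Binary.PropositionalEquality using (refl; cong₂; sym; trans)

private
  eqb-sym : ∀ {n} (u v : Fin n) → ⌊ u ≟ v ⌋ ≡ ⌊ v ≟ u ⌋
  eqb-sym u v with u ≟ v | v ≟ u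
  ... | Relation.Nullary.yes _ | Relation.Nullary.yes _ = refl
  ... | Relation.Nullary.no _  | Relation.Nullary.no _  = refl
  ... | Relation.Nullary.yes p | Relation.Nullary.no q  = Data.Empty.⊥-elim (q (sym p))
    where import Data.Empty
  ... | Relation.Nullary.no p  | Relation.Nullary.yes q = Data.Empty.⊥-elim (p (sym q))
    where import Data.Empty

  eqb-refl : ∀ {n} (v : Fin n) → ⌊ v ≟ v ⌋ ≡ true
  eqb-refl v with v ≟ v
  ... | Relation.Nullary.yes _ = refl
  ... | Relation.Nullary.no p  = Data.Empty.⊥-elim (p refl)
    where import Data.Empty

  and-false : ∀ b → b ∧ false ≡ false
  and-false true  = refl
  and-false false = refl

complement : ∀ {n} → Graph n → Graph n
complement G = record
  { adj    = λ u v → not (adj G u v) ∧ not ⌊ u ≟ v ⌋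
  ; adj-sym    = λ u v → cong₂ (λ a b → not a ∧ not b) (Graph.adj-sym G u v) (eqb-sym u v)
  ; adj-irrefl = λ v → trans (cong₂ (λ a b → not a ∧ not b) refl (eqb-refl v)) (and-false (not (adj G v v)))
  }

module _ {n : ℕ} (G : Graph n) where

  IsClique : Subset n → Set
  IsClique C = ∀ u v → u ∈ C → v ∈ C → u ≢ v → adj G u v ≡ true

  IsStable : Subset n → Set
  IsStable S = ∀ u v → u ∈ S → v ∈ S → adj G u v ≡ false

  IsMaximalClique : Subset n → Set
  IsMaximalClique C = IsClique C × (∀ D → IsClique D → C ⊆ D → D ⊆ C)

  IsMaximalStable : Subset n → Set
  IsMaximalStable S = IsStable S × (∀ D → IsStable D → S ⊆ D → D ⊆ S)

  IsSplit : Set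
  IsSplit = Σ (Subset n) λ C → Σ (Subset n) λ S →
              IsClique C × IsStable S ×
              (∀ v → v ∈ C → v ∉ S) × (∀ v → v ∈ C ⊎ v ∈ S)

  Intersect : Subset n → Subset n → Set
  Intersect C S = ∃[ v ] (v ∈ C × v ∈ S)

  IsAlmostCIS : Set
  IsAlmostCIS = Σ (Subset n) λ C₀ → Σ (Subset n) λ S₀ →
                  IsMaximalClique C₀ × IsMaximalStable S₀ × ¬ Intersect C₀ S₀ ×
                  (∀ C S → IsMaximalClique C → IsMaximalStable S → ¬ Intersect C S →
                     C ≡ C₀ × S ≡ S₀)

  N[_] : Fin n → Subset n
  N[ v ] = tabulate (λ u → adj G v u ∨ ⌊ u ≟ v ⌋)

  IsSimplicialClique : Subset n → Set
  IsSimplicialClique K = IsClique K × ∃[ v ] (K ≡ N[ v ])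

  IsEdgeSimplicial : Set
  IsEdgeSimplicial = ∀ u v → adj G u v ≡ true →
                       ∃[ K ] (IsSimplicialClique K × u ∈ K × v ∈ K)

IsCapEdgeSimplicial : ∀ {n} → Graph n → Set
IsCapEdgeSimplicial G = IsEdgeSimplicial G × IsEdgeSimplicial (complement G)

{-# OPTIONS --safe #-}
module Submission where

-- The hard part is that an almost CIS graph, with disjoint pair (A , B), is
-- covered by A ∪ B. Argue by induction on the number of vertices and suppose
-- that something lies outside A ∪ B. Extending suitable cliques and stable sets
-- gives a vertex v outside and c₀ ∈ A with N(v) ∩ B ⊆ N(c₀), c₀ not adjacent
-- to v, and c₀ adjacent to some vertex outside A ∪ B. The induction hypothesis
-- for the graph induced on N(c₀) then gives c ∈ A such that N(c) ∩ N(c₀) ∩ B is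
-- empty. Let y ∈ N(v) ∩ B, let S₁ be a maximal stable set containing c and
-- B ∖ N(c), let S₂ be one containing v and S₁ ∖ B, and let K₁ be a maximal
-- clique containing y and N(y) ∩ A. They meet in a vertex w ∈ K₁ ∩ S₂ outside
-- A ∪ B, and the dual argument gives y′ ∈ B with A ⊆ N(y) ∪ N(y′), whence
-- w ~ y′. A maximal clique through w and y′ cannot meet S₁, a contradiction.
--
-- If G and its complement are edge simplicial, then either some vertex is
-- simplicial in both, so that its neighbourhood is a clique with stable
-- complement, or the vertices simplicial in G form a stable set and all the
-- others, simplicial in the complement, form a clique.
--
-- Conversely, if (C , S) is a split partition, either some vertex is simplicial
-- in both graphs, which makes both edge simplicial, or C and S are maximal
-- and form the only disjoint pair.

open import Defs
open import Data.Bool using (Bool; true; false; not; _∧_; _∨_)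
open import Data.Bool.Properties using (∨-zeroʳ; ∨-identityʳ) renaming (_≟_ to _≟ᵇ_)
open import Data.Empty using (⊥; ⊥-elim)
open import Data.Fin using (Fin; _≟_)
open import Data.Fin.Properties using (any?; all?)
open import Data.Fin.Subset using (Subset; _∈_; _∉_; _⊆_; _⊃_; ⊤; ∁; ∣_∣)
open import Data.Fin.Subset.Induction using (Acc; acc; ⊃-wellFounded)
open import Data.Fin.Subset.Properties using (_∈?_; ⊆-antisym; ⊆⊤; ∈⊤; p⊂q⇒∣p∣<∣q∣; x∉p⇒x∈∁p; x∈∁p⇒x∉p; x∈p⇒x∉∁p)
open import Data.Nat using (ℕ; zero; suc; _<_)
open import Data.Nat.Properties using (<-≤-trans; ≤-pred; ≤-refl)
open import Data.Product using (_×_; ∃; ∃-syntax; _,_; proj₁; proj₂)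
open import Data.Sum using (_⊎_; inj₁; inj₂; [_,_]′)
open import Data.Vec using (tabulate)
open import Data.Vec.Properties using (lookup∘tabulate; lookup⇒[]=; []=⇒lookup)
open import Function using (_∘_; id)
open import Level using (0ℓ)
open import Relation.Binary using (Rel; Symmetric)
import Relation.Binary as Binary
open import Relation.Binary.PropositionalEquality using (_≡_; _≢_; refl; sym; trans; subst; ≢-sym)
open import Relation.Nullary using (¬_; Dec; yes; no; does; contradiction)
open import Relation.Nullary.Decidable using (_×-dec_; _⊎-dec_; _→-dec_; ¬?; dec-true; ⌊_⌋)
open import Relation.Unary using (Pred; Decidable)

private
  variable
    n : ℕ

-- Subsets given by decidable predicates

∈-tabulate⁺ : {f : Fin n → Bool} {x : Fin n} → f x ≡ true → x ∈ tabulate f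
∈-tabulate⁺ {f = f} {x} fx = lookup⇒[]= x _ (trans (lookup∘tabulate f x) fx)

∈-tabulate⁻ : {f : Fin n → Bool} {x : Fin n} → x ∈ tabulate f → f x ≡ true
∈-tabulate⁻ {f = f} {x} x∈ = trans (sym (lookup∘tabulate f x)) ([]=⇒lookup x∈)

module _ {P : Pred (Fin n) 0ℓ} (P? : Decidable P) where

  comprehension : Subset n
  comprehension = tabulate (does ∘ P?)

  ∈-comprehension⁺ : ∀ {x} → P x → x ∈ comprehension
  ∈-comprehension⁺ {x} px = ∈-tabulate⁺ (dec-true (P? x) px)

  ∈-comprehension⁻ : ∀ {x} → x ∈ comprehension → P x
  ∈-comprehension⁻ {x} x∈ with P? x | ∈-tabulate⁻ {f = does ∘ P?} x∈
  ... | yes px | _  = px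
  ... | no _   | ()

∈∉⇒≢ : {x y : Fin n} {p : Subset n} → x ∈ p → y ∉ p → x ≢ y
∈∉⇒≢ x∈p y∉p refl = y∉p x∈p

-- Maximal homogeneous sets and their existence

Homogeneous : Rel (Fin n) 0ℓ → Subset n → Set
Homogeneous R K = ∀ {x y} → x ∈ K → y ∈ K → x ≢ y → R x y

module _ (K : Subset n) (x : Fin n) where

  Adjoin : Pred (Fin n) 0ℓ
  Adjoin z = z ∈ K ⊎ z ≡ x

  adjoin? : Decidable Adjoin
  adjoin? z = z ∈? K ⊎-dec z ≟ x

adjoin-homogeneous : ∀ {R : Rel (Fin n) 0ℓ} {K x} → Symmetric R → Homogeneous R K →
                     (∀ {y} → y ∈ K → x ≢ y → R x y) →
                     ∀ {a b} → Adjoin K x a → Adjoin K x b → a ≢ b → R a b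
adjoin-homogeneous R-sym hom h (inj₁ a∈K)  (inj₁ b∈K)  a≢b = hom a∈K b∈K a≢b
adjoin-homogeneous R-sym hom h (inj₁ a∈K)  (inj₂ refl) a≢b = R-sym (h a∈K (≢-sym a≢b))
adjoin-homogeneous R-sym hom h (inj₂ refl) (inj₁ b∈K)  a≢b = h b∈K a≢b
adjoin-homogeneous R-sym hom h (inj₂ refl) (inj₂ refl) a≢b = contradiction refl a≢b

-- Relative to `U`, so that induced subgraphs need no renumbering of vertices. Maximality is tested
-- one vertex at a time instead of against larger sets.
record Maximal (R : Rel (Fin n) 0ℓ) (U K : Subset n) : Set where
  field
    within      : K ⊆ U
    homogeneous : Homogeneous R K
    closed      : ∀ {x} → x ∈ U → (∀ {y} → y ∈ K → x ≢ y → R x y) → x ∈ K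

open Maximal

module _ {R : Rel (Fin n) 0ℓ} (R? : Binary.Decidable R) (R-sym : Symmetric R) {U : Subset n} where

  private
    Extends : Subset n → Fin n → Set
    Extends K x = (x ∈ U × x ∉ K) × (∀ y → y ∈ K → x ≢ y → R x y)

    extends? : ∀ K → Decidable (Extends K)
    extends? K x = (x ∈? U ×-dec ¬? (x ∈? K))
      ×-dec all? (λ y → y ∈? K →-dec (¬? (x ≟ y) →-dec R? x y))

    -- Vertices are adjoined one at a time, which ends because a chain of strictly growing subsets
    -- of a finite set is finite.
    grow : ∀ K → Acc _⊃_ K → K ⊆ U → Homogeneous R K →
           ∃[ K′ ] (Maximal R U K′ × K ⊆ K′)
    grow K (acc rec) K⊆U hom with any? (extends? K)
    ... | no none = K , record { within = K⊆U ; homogeneous = hom ; closed = clo } , id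
      where
      clo : ∀ {x} → x ∈ U → (∀ {y} → y ∈ K → x ≢ y → R x y) → x ∈ K
      clo {x} x∈U h with x ∈? K
      ... | yes x∈K = x∈K
      ... | no  x∉K = contradiction (x , (x∈U , x∉K) , λ _ → h) none
    ... | yes (x , (x∈U , x∉K) , h) =
      let K′ , max , K⁺⊆K′ = grow K⁺ (rec (K⊆K⁺ , x , ∈-comprehension⁺ K⁺? (inj₂ refl) , x∉K)) K⁺⊆U hom⁺
      in  K′ , max , K⁺⊆K′ ∘ K⊆K⁺
      where
      K⁺? = adjoin? K x
      K⁺ : Subset _
      K⁺ = comprehension K⁺?
      K⊆K⁺ : K ⊆ K⁺
      K⊆K⁺ = ∈-comprehension⁺ K⁺? ∘ inj₁
      K⁺⊆U : K⁺ ⊆ U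
      K⁺⊆U z∈ with ∈-comprehension⁻ K⁺? z∈
      ... | inj₁ z∈K  = K⊆U z∈K
      ... | inj₂ refl = x∈U
      hom⁺ : Homogeneous R K⁺
      hom⁺ a∈ b∈ = adjoin-homogeneous R-sym hom (h _) (∈-comprehension⁻ K⁺? a∈) (∈-comprehension⁻ K⁺? b∈)

  extend : {P : Pred (Fin n) 0ℓ} → Decidable P → (∀ {x} → P x → x ∈ U) →
           (∀ {x y} → P x → P y → x ≢ y → R x y) →
           ∃[ K ] (Maximal R U K × (∀ {x} → P x → x ∈ K))
  extend P? P⊆U hom =
    let K , max , ⊆K = grow (comprehension P?) (⊃-wellFounded _)
                         (λ x∈ → P⊆U (∈-comprehension⁻ P? x∈))
                         (λ x∈ y∈ → hom (∈-comprehension⁻ P? x∈) (∈-comprehension⁻ P? y∈))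
    in  K , max , λ px → ⊆K (∈-comprehension⁺ P? px)

-- Adjacency and non-adjacency of a graph on an equal footing, so that
-- complementation is the symmetry `dual`.
record Dichotomy (n : ℕ) : Set₁ where
  infix 4 _~_ _≁_
  field
    _~_ _≁_  : Rel (Fin n) 0ℓ
    ~?       : Binary.Decidable _~_
    ≁?       : Binary.Decidable _≁_
    ~-sym    : Symmetric _~_
    ≁-sym    : Symmetric _≁_
    ~-irrefl : ∀ {x} → ¬ x ~ x
    ≁-irrefl : ∀ {x} → ¬ x ≁ x
    exclusive : ∀ {x y} → x ~ y → ¬ x ≁ y
    total     : ∀ {x y} → x ≢ y → x ~ y ⊎ x ≁ y

dual : Dichotomy n → Dichotomy n
dual D = record
  { _~_ = _≁_ ; _≁_ = _~_ ; ~? = ≁? ; ≁? = ~? ; ~-sym = ≁-sym ; ≁-sym = ~-sym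
  ; ~-irrefl = ≁-irrefl ; ≁-irrefl = ~-irrefl
  ; exclusive = λ x≁y x~y → exclusive x~y x≁y
  ; total = λ x≢y → [ inj₂ , inj₁ ]′ (total x≢y)
  } where open Dichotomy D

-- Almost CIS graphs

-- The subgraph induced by U has no pair of disjoint maximal clique and maximal
-- stable set besides (A , B).
record AlmostCIS (D : Dichotomy n) (U A B : Subset n) : Set where
  open Dichotomy D
  field
    A-max    : Maximal _~_ U A
    B-max    : Maximal _≁_ U B
    disjoint : ∀ {x} → x ∈ A → x ∉ B
    meet-K   : ∀ {K S x} → Maximal _~_ U K → Maximal _≁_ U S → x ∈ K → x ∉ A → ∃[ y ] (y ∈ K × y ∈ S)
    meet-S   : ∀ {K S x} → Maximal _~_ U K → Maximal _≁_ U S → x ∈ S → x ∉ B → ∃[ y ] (y ∈ K × y ∈ S)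

swap : ∀ {D : Dichotomy n} {U A B} → AlmostCIS D U A B → AlmostCIS (dual D) U B A
swap cis = record
  { A-max = B-max ; B-max = A-max ; disjoint = λ x∈B x∈A → disjoint x∈A x∈B
  ; meet-K = λ S K x∈S x∉B → let y , y∈K , y∈S = meet-S K S x∈S x∉B in y , y∈S , y∈K
  ; meet-S = λ S K x∈K x∉A → let y , y∈K , y∈S = meet-K K S x∈K x∉A in y , y∈S , y∈K
  } where open AlmostCIS cis

record Outside (U A B : Subset n) (x : Fin n) : Set where
  constructor outside
  field
    ∈U : x ∈ U
    ∉A : x ∉ A
    ∉B : x ∉ B

open Outside

flip : ∀ {U A B : Subset n} {x} → Outside U A B x → Outside U B A x
flip (outside x∈U x∉A x∉B) = outside x∈U x∉B x∉A

-- Neighbourhoods and stars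

module _ (D : Dichotomy n) where
  open Dichotomy D

  private
    nbr? : ∀ c K → Decidable (λ x → x ∈ K × c ~ x)
    nbr? c K x = x ∈? K ×-dec ~? c x

  nbrs : Fin n → Subset n → Subset n
  nbrs c K = comprehension (nbr? c K)

  ∈-nbrs⁺ : ∀ {c K x} → x ∈ K → c ~ x → x ∈ nbrs c K
  ∈-nbrs⁺ x∈K c~x = ∈-comprehension⁺ (nbr? _ _) (x∈K , c~x)

  ∈-nbrs⁻ : ∀ {c K x} → x ∈ nbrs c K → x ∈ K × c ~ x
  ∈-nbrs⁻ = ∈-comprehension⁻ (nbr? _ _)

  nbrs-homogeneous : ∀ {c K R} → Homogeneous R K → Homogeneous R (nbrs c K)
  nbrs-homogeneous hom x∈ y∈ = hom (proj₁ (∈-nbrs⁻ x∈)) (proj₁ (∈-nbrs⁻ y∈))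

  nbrs-mono : ∀ {c K L} → K ⊆ L → nbrs c K ⊆ nbrs c L
  nbrs-mono K⊆L x∈ = let x∈K , c~x = ∈-nbrs⁻ x∈ in ∈-nbrs⁺ (K⊆L x∈K) c~x

  ~⇒≢ : ∀ {x y} → x ~ y → x ≢ y
  ~⇒≢ x~y refl = ~-irrefl x~y

  ¬~⇒≁ : ∀ {x y} → x ≢ y → ¬ x ~ y → x ≁ y
  ¬~⇒≁ x≢y ¬x~y = [ (λ x~y → contradiction x~y ¬x~y) , id ]′ (total x≢y)

  ≁⇒∉ : ∀ {U K x y} → Maximal _~_ U K → x ∈ K → x ≁ y → y ∉ K
  ≁⇒∉ K-max x∈K x≁y y∈K = exclusive (homogeneous K-max x∈K y∈K (λ { refl → ≁-irrefl x≁y })) x≁y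

  outside⇒≁ : ∀ {U K x} → Maximal _~_ U K → x ∈ U → x ∉ K → ∃[ y ] (y ∈ K × x ≁ y)
  outside⇒≁ {K = K} {x} K-max x∈U x∉K with any? (λ y → y ∈? K ×-dec ≁? x y)
  ... | yes found = found
  ... | no none = contradiction
    (closed K-max x∈U λ {y} y∈K x≢y →
      [ id , (λ x≁y → contradiction (y , y∈K , x≁y) none) ]′ (total x≢y)) x∉K

  maximal-edge : ∀ {U x y} → x ∈ U → y ∈ U → x ~ y → ∃[ K ] (Maximal _~_ U K × x ∈ K × y ∈ K)
  maximal-edge {U} {x} {y} x∈U y∈U x~y =
    let K , K-max , ⊆K = extend ~? ~-sym (λ z → z ≟ x ⊎-dec z ≟ y)
                           (λ { (inj₁ refl) → x∈U ; (inj₂ refl) → y∈U })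
                           (λ { (inj₁ refl) (inj₁ refl) x≢x → contradiction refl x≢x
                              ; (inj₁ refl) (inj₂ refl) _   → x~y
                              ; (inj₂ refl) (inj₁ refl) _   → ~-sym x~y
                              ; (inj₂ refl) (inj₂ refl) y≢y → contradiction refl y≢y })
    in  K , K-max , ⊆K (inj₁ refl) , ⊆K (inj₂ refl)

  -- Every member z of `set` satisfies N(z) ∩ B ⊆ N(x): a vertex of `B` not adjacent to `x` is a
  -- leaf, so it cannot be adjacent to z.
  record Star (U B : Subset n) (x : Fin n) : Set where
    field
      set     : Subset n
      maximal : Maximal _≁_ U set
      centre  : x ∈ set
      leaf    : ∀ {b} → b ∈ B → b ≁ x → b ∈ set

  star : ∀ {U B x} → Maximal _≁_ U B → x ∈ U → Star U B x
  star {U} {B} {x} B-max x∈U =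
    let S , S-max , ⊆S = extend ≁? ≁-sym (λ z → z ≟ x ⊎-dec (z ∈? B ×-dec ≁? z x))
                           (λ { (inj₁ refl) → x∈U ; (inj₂ (z∈B , _)) → within B-max z∈B })
                           (λ { (inj₁ refl) (inj₁ refl) x≢x → contradiction refl x≢x
                              ; (inj₁ refl) (inj₂ (_ , z≁x)) _ → ≁-sym z≁x
                              ; (inj₂ (_ , z≁x)) (inj₁ refl) _ → z≁x
                              ; (inj₂ (y∈B , _)) (inj₂ (z∈B , _)) y≢z → homogeneous B-max y∈B z∈B y≢z })
    in  record { set = S ; maximal = S-max ; centre = ⊆S (inj₁ refl)
               ; leaf = λ b∈B b≁x → ⊆S (inj₂ (b∈B , b≁x)) }

-- Comparing neighbourhoods of outside vertices

module _ (D : Dichotomy n) {U A B : Subset n} (cis : AlmostCIS D U A B) where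
  open Dichotomy D
  open AlmostCIS cis

  private
    W : Fin n → Set
    W = Outside U A B

    A⊆U : A ⊆ U
    A⊆U = within A-max

    A≢B : ∀ {a b} → a ∈ A → b ∈ B → b ≢ a
    A≢B a∈A b∈B refl = disjoint a∈A b∈B

  infix 4 _≼_
  -- For the dual graph this reads N(x) ∩ A ⊇ N(y) ∩ A.
  _≼_ : Fin n → Fin n → Set
  x ≼ y = ∀ {b} → b ∈ B → b ~ x → b ~ y

  -- The star at `w` differs from `B`, so it meets `A`. The meeting vertex inherits `_≼_` from the
  -- leaves.
  lower-A : ∀ {w} → W w → ∃[ c ] (c ∈ A × c ≁ w × c ≼ w)
  lower-A {w} (outside w∈U w∉A w∉B) =
    let open Star (star D B-max w∈U)
        c , c∈A , c∈S = meet-S A-max maximal centre w∉B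
        c≁w = homogeneous maximal c∈S centre (∈∉⇒≢ c∈A w∉A)
    in  c , c∈A , c≁w , λ {b} b∈B b~c →
        [ id , (λ b≁w → contradiction (leaf b∈B b≁w) (≁⇒∉ (dual D) maximal c∈S (~-sym b~c))) ]′
          (total (∈∉⇒≢ b∈B w∉B))

  Shadow : Fin n → Fin n → Set
  Shadow c v = W v × c ≁ v × v ≼ c

  -- Some y in `B` is adjacent to `c`, hence to `w`. A maximal clique through y and `w` meets the
  -- star at `c` in a vertex x other than `c` and y. Non-adjacency to `c` keeps x out of `A`,
  -- adjacency to y keeps it out of `B`, and the star gives x ≼ c.
  lower-W : ∀ {c w} → c ∈ A → W w → c ≁ w → c ≼ w → ∃[ v ] Shadow c v
  lower-W {c} {w} c∈A (outside w∈U w∉A w∉B) c≁w c≼w =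
    let y , y∈B , c~y = outside⇒≁ (dual D) B-max (A⊆U c∈A) (disjoint c∈A)
        y~c = ~-sym c~y
        open Star (star D B-max (A⊆U c∈A))
        K , K-max , y∈K , w∈K = maximal-edge D (within B-max y∈B) w∈U (c≼w y∈B y~c)
        x , x∈K , x∈S = meet-K K-max maximal w∈K w∉A
        x≢c : x ≢ c
        x≢c = ∈∉⇒≢ x∈K (≁⇒∉ D K-max w∈K (≁-sym c≁w))
        c≁x = homogeneous maximal centre x∈S (≢-sym x≢c)
        x∉A : x ∉ A
        x∉A = ≁⇒∉ D A-max c∈A c≁x
        x≢y : x ≢ y
        x≢y = ∈∉⇒≢ x∈S (≁⇒∉ (dual D) maximal centre c~y)
        x∉B : x ∉ B
        x∉B = λ x∈B → exclusive (homogeneous K-max x∈K y∈K x≢y) (homogeneous B-max x∈B y∈B x≢y)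
    in  x , outside (within K-max x∈K) x∉A x∉B , c≁x , λ {b} b∈B b~x →
        [ id , (λ b≁c → contradiction (leaf b∈B b≁c) (≁⇒∉ (dual D) maximal x∈S (~-sym b~x))) ]′
          (total (A≢B c∈A b∈B))

  -- A maximal clique through `v` and `x` differs from `A`, because it contains `v`, and so it meets
  -- `B`.
  common-neighbour : ∀ {v x} → W v → x ∈ U → x ∉ B → v ~ x → ∃[ b ] (b ∈ B × b ~ v × b ~ x)
  common-neighbour (outside v∈U v∉A v∉B) x∈U x∉B v~x =
    let K , K-max , v∈K , x∈K = maximal-edge D v∈U x∈U v~x
        b , b∈K , b∈B = meet-K K-max B-max v∈K v∉A
    in  b , b∈B , homogeneous K-max b∈K v∈K (∈∉⇒≢ b∈B v∉B) , homogeneous K-max b∈K x∈K (∈∉⇒≢ b∈B x∉B)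

module _ (D : Dichotomy n) {U A B : Subset n} (cis : AlmostCIS D U A B) where
  open Dichotomy D
  open AlmostCIS cis

  -- In the dual, `lower-A` at `v` gives s in `B` with s ~ v, and `lower-W` gives w outside with
  -- N(s) ∩ A ⊆ N(w). From s ~ v and v ≼ c follows s ~ c, whence c ~ w.
  shadowed⇒neighbour : ∀ {c v} → c ∈ A → Shadow D cis c v → ∃[ w ] (Outside U A B w × c ~ w)
  shadowed⇒neighbour {c} c∈A (v∉ , c≁v , v≼c) =
    let s , s∈B , s~v , s≼v = lower-A (dual D) (swap cis) (flip v∉)
        w , w∉ , s~w , w≼s = lower-W (dual D) (swap cis) s∈B (flip v∉) s~v s≼v
        s~c = v≼c s∈B s~v
    in  w , flip w∉ , [ id , (λ c≁w → contradiction (w≼s c∈A c≁w) (exclusive (~-sym s~c))) ]′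
          (total (∈∉⇒≢ c∈A (∉B w∉)))

  module _ {c : Fin n} (c∈A : c ∈ A) where

    private
      link linkA linkB : Subset n
      link  = nbrs D c U
      linkA = nbrs D c A
      linkB = nbrs D c B

    ∣link∣<∣U∣ : ∣ link ∣ < ∣ U ∣
    ∣link∣<∣U∣ = p⊂q⇒∣p∣<∣q∣
      ( (λ x∈ → proj₁ (∈-nbrs⁻ D x∈))
      , c , within A-max c∈A , λ c∈ → ~-irrefl (proj₂ (∈-nbrs⁻ D c∈)))

    -- Since `c` is in `A` and adjacent to the whole link, a vertex of the link complete to `linkA`
    -- is complete to `A`. Nothing similar holds for `linkB`, so its maximality is assumed.
    link-almostCIS : Maximal _≁_ link linkB → AlmostCIS D link linkA linkB
    link-almostCIS linkB-max = record
      { A-max = record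
        { within = nbrs-mono D (within A-max)
        ; homogeneous = nbrs-homogeneous D (homogeneous A-max)
        ; closed = closedA
        }
      ; B-max = linkB-max
      ; disjoint = λ x∈A x∈B → disjoint (proj₁ (∈-nbrs⁻ D x∈A)) (proj₁ (∈-nbrs⁻ D x∈B))
      ; meet-K = λ K-max S-max x∈K x∉A →
          let _ , c~x = ∈-nbrs⁻ D (within K-max x∈K)
          in meet K-max S-max (within K-max x∈K) λ K⁺-max S⁺-max K⊆K⁺ _ →
               meet-K K⁺-max S⁺-max (K⊆K⁺ x∈K) (λ x∈A → x∉A (∈-nbrs⁺ D x∈A c~x))
      ; meet-S = λ K-max S-max x∈S x∉B →
          let _ , c~x = ∈-nbrs⁻ D (within S-max x∈S)
          in meet K-max S-max (within S-max x∈S) λ K⁺-max S⁺-max _ S⊆S⁺ →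
               meet-S K⁺-max S⁺-max (S⊆S⁺ x∈S) (λ x∈B → x∉B (∈-nbrs⁺ D x∈B c~x))
      }
      where
      closedA : ∀ {x} → x ∈ link → (∀ {y} → y ∈ linkA → x ≢ y → x ~ y) → x ∈ linkA
      closedA {x} x∈ h = ∈-nbrs⁺ D (closed A-max (proj₁ (∈-nbrs⁻ D x∈)) complete) (proj₂ (∈-nbrs⁻ D x∈))
        where
        complete : ∀ {y} → y ∈ A → x ≢ y → x ~ y
        complete {y} y∈A x≢y with y ≟ c
        ... | yes refl = ~-sym (proj₂ (∈-nbrs⁻ D x∈))
        ... | no y≢c   = h (∈-nbrs⁺ D y∈A (homogeneous A-max c∈A y∈A (≢-sym y≢c))) x≢y

      -- K ∪ {c} is a maximal clique of U, and a maximal stable set of U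
      -- extending S traces S on the link.
      meet : ∀ {K S x} → Maximal _~_ link K → Maximal _≁_ link S → x ∈ link →
             (∀ {K⁺ S⁺} → Maximal _~_ U K⁺ → Maximal _≁_ U S⁺ → K ⊆ K⁺ → S ⊆ S⁺ → ∃[ y ] (y ∈ K⁺ × y ∈ S⁺)) →
             ∃[ y ] (y ∈ K × y ∈ S)
      meet {K} {S} {x} K-max S-max x∈ meet⁺ =
        let S⁺ , S⁺-max , S⊆S⁺ = extend ≁? ≁-sym (_∈? S) (λ z∈S → proj₁ (in-link (within S-max z∈S))) (homogeneous S-max)
            y , y∈K⁺ , y∈S⁺ = meet⁺ K⁺-max S⁺-max (∈-comprehension⁺ K⁺? ∘ inj₁) S⊆S⁺
        in  trace S⁺-max S⊆S⁺ y∈S⁺ (∈-comprehension⁻ K⁺? y∈K⁺)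
        where
        in-link : ∀ {z} → z ∈ link → z ∈ U × c ~ z
        in-link = ∈-nbrs⁻ D
        K⁺? = adjoin? K c
        K⁺ : Subset n
        K⁺ = comprehension K⁺?
        K⁺-max : Maximal _~_ U K⁺
        K⁺-max = record { within = w ; homogeneous = h ; closed = cl }
          where
          w : K⁺ ⊆ U
          w z∈ with ∈-comprehension⁻ K⁺? z∈
          ... | inj₁ z∈K  = proj₁ (in-link (within K-max z∈K))
          ... | inj₂ refl = within A-max c∈A
          h : Homogeneous _~_ K⁺
          h a∈ b∈ = adjoin-homogeneous ~-sym (homogeneous K-max) (λ y∈K _ → proj₂ (in-link (within K-max y∈K)))
                      (∈-comprehension⁻ K⁺? a∈) (∈-comprehension⁻ K⁺? b∈)
          cl : ∀ {z} → z ∈ U → (∀ {y} → y ∈ K⁺ → z ≢ y → z ~ y) → z ∈ K⁺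
          cl {z} z∈U complete with z ≟ c
          ... | yes z≡c = ∈-comprehension⁺ K⁺? (inj₂ z≡c)
          ... | no  z≢c = ∈-comprehension⁺ K⁺? (inj₁ (closed K-max
            (∈-nbrs⁺ D z∈U (~-sym (complete (∈-comprehension⁺ K⁺? (inj₂ refl)) z≢c)))
            (complete ∘ ∈-comprehension⁺ K⁺? ∘ inj₁)))
        trace : ∀ {S⁺ y} → Maximal _≁_ U S⁺ → S ⊆ S⁺ → y ∈ S⁺ → y ∈ K ⊎ y ≡ c → ∃[ y ] (y ∈ K × y ∈ S)
        trace S⁺-max S⊆S⁺ y∈S⁺ (inj₁ y∈K) =
          _ , y∈K , closed S-max (within K-max y∈K) (λ z∈S → homogeneous S⁺-max y∈S⁺ (S⊆S⁺ z∈S))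
        -- The two sets cannot meet in `c`: `S` is nonempty, since the link contains `x`, and all of
        -- `S` is adjacent to `c`.
        trace S⁺-max S⊆S⁺ c∈S⁺ (inj₂ refl) =
          let z , z∈S = nonempty
              c~z = proj₂ (in-link (within S-max z∈S))
          in  contradiction (S⊆S⁺ z∈S) (≁⇒∉ (dual D) S⁺-max c∈S⁺ c~z)
          where
          nonempty : ∃[ z ] z ∈ S
          nonempty with x ∈? S
          ... | yes x∈S = x , x∈S
          ... | no  x∉S = let z , z∈S , _ = outside⇒≁ (dual D) S-max x∈ x∉S in z , z∈S

-- The induction is on the size of `U`, as the vertex type stays fixed. Quantifying over `D` lets
-- the hypothesis serve the dual as well.
Covered : ℕ → ℕ → Set₁
Covered n k = ∀ (D : Dichotomy n) {U A B} → ∣ U ∣ < k → AlmostCIS D U A B → ∀ {x} → ¬ Outside U A B x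

module _ {k : ℕ} (ih : Covered n k) where

  -- The neighbourhood of c is almost CIS unless N(c) ∩ B is extendable in it;
  -- in the first case it would be covered by A and B, contrary to w.
  partner : ∀ (D : Dichotomy n) {U A B} → ∣ U ∣ < suc k → (cis : AlmostCIS D U A B) → let open Dichotomy D in
            ∀ {c w} → c ∈ A → Outside U A B w → c ~ w →
            ∃[ c′ ] (c′ ∈ A × (∀ {b} → b ∈ B → b ~ c → ¬ b ~ c′))
  partner D {U} {A} {B} size cis {c} {w} c∈A w∉ c~w
    with any? (λ u → (u ∈? U ×-dec ~? c u) ×-dec (¬? (u ∈? B) ×-dec all? (λ b → (b ∈? B ×-dec ~? c b) →-dec ¬? (~? b u))))
    where open Dichotomy D
  ... | yes (u , (u∈U , c~u) , u∉B , anti) = from (u ∈? A)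
    where
    open Dichotomy D
    from : Dec (u ∈ A) → ∃[ c′ ] (c′ ∈ A × (∀ {b} → b ∈ B → b ~ c → ¬ b ~ c′))
    from (yes u∈A) = u , u∈A , λ b∈B b~c → anti _ (b∈B , ~-sym b~c)
    -- `lower-A` moves `u` into `A` without giving it new neighbours in `B`.
    from (no  u∉A) =
      let c′ , c′∈A , _ , c′≼u = lower-A D cis (outside u∈U u∉A u∉B)
      in  c′ , c′∈A , λ b∈B b~c b~c′ → anti _ (b∈B , ~-sym b~c) (c′≼u b∈B b~c′)
  ... | no none = contradiction
    (outside (∈-nbrs⁺ D (∈U w∉) c~w)
             (λ w∈ → ∉A w∉ (proj₁ (∈-nbrs⁻ D w∈)))
             (λ w∈ → ∉B w∉ (proj₁ (∈-nbrs⁻ D w∈))))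
    (ih D (<-≤-trans (∣link∣<∣U∣ D cis c∈A) (≤-pred size)) (link-almostCIS D cis c∈A linkB-max))
    where
    open Dichotomy D
    open AlmostCIS cis
    closedB : ∀ {x} → x ∈ nbrs D c U → (∀ {y} → y ∈ nbrs D c B → x ≢ y → x ≁ y) → x ∈ nbrs D c B
    closedB {x} x∈ h with x ∈? B | ∈-nbrs⁻ D x∈
    ... | yes x∈B | _   , c~x = ∈-nbrs⁺ D x∈B c~x
    ... | no  x∉B | x∈U , c~x = contradiction
      (x , (x∈U , c~x) , x∉B , λ b (b∈B , c~b) b~x →
        exclusive (~-sym b~x) (h (∈-nbrs⁺ D b∈B c~b) (≢-sym (~⇒≢ D b~x)))) none
    linkB-max : Maximal _≁_ (nbrs D c U) (nbrs D c B)
    linkB-max = record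
      { within = nbrs-mono D (within B-max)
      ; homogeneous = nbrs-homogeneous D (homogeneous B-max)
      ; closed = closedB
      }

  -- The contradiction from an uncovered vertex

  module _ (D : Dichotomy n) {U A B : Subset n} (size : ∣ U ∣ < suc k) (cis : AlmostCIS D U A B) where
    open Dichotomy D
    open AlmostCIS cis

    module Obstruction {v c y : Fin n} (v∉ : Outside U A B v) (c∈A : c ∈ A) (y∈B : y ∈ B) (y~v : y ~ v)
                       (¬common : ∀ {b} → b ∈ B → b ~ v → ¬ b ~ c) where

      private
        module S₁ = Star (star D B-max (within A-max c∈A))
        module K₁ = Star (star (dual D) A-max (within B-max y∈B))

        y∉A : y ∉ A
        y∉A y∈A = disjoint y∈A y∈B

        c∉B : c ∉ B
        c∉B = disjoint c∈A

        y≁c : y ≁ c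
        y≁c = ¬~⇒≁ D (∈∉⇒≢ y∈B c∉B) (¬common y∈B y~v)

        -- A common neighbour b of `v` and `x` in `B` is not adjacent to `c`, so it lies in S₁ next
        -- to its neighbour `x`.
        v≁S₁∖B : ∀ {x} → x ∈ S₁.set → x ∉ B → v ≢ x → v ≁ x
        v≁S₁∖B x∈S₁ x∉B v≢x = ¬~⇒≁ D v≢x λ v~x →
          let b , b∈B , b~v , b~x = common-neighbour D cis v∉ (within S₁.maximal x∈S₁) x∉B v~x
              b≁c = ¬~⇒≁ D (∈∉⇒≢ b∈B c∉B) (¬common b∈B b~v)
          in  ≁⇒∉ (dual D) S₁.maximal (S₁.leaf b∈B b≁c) b~x x∈S₁

        S₂-exists : ∃[ S ] (Maximal _≁_ U S × (∀ {z} → z ≡ v ⊎ (z ∈ S₁.set × z ∉ B) → z ∈ S))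
        S₂-exists = extend ≁? ≁-sym (λ z → z ≟ v ⊎-dec (z ∈? S₁.set ×-dec ¬? (z ∈? B)))
          (λ { (inj₁ refl) → ∈U v∉ ; (inj₂ (z∈S₁ , _)) → within S₁.maximal z∈S₁ })
          (λ { (inj₁ refl) (inj₁ refl) v≢v → contradiction refl v≢v
             ; (inj₁ refl) (inj₂ (z∈ , z∉B)) v≢z → v≁S₁∖B z∈ z∉B v≢z
             ; (inj₂ (z∈ , z∉B)) (inj₁ refl) z≢v → ≁-sym (v≁S₁∖B z∈ z∉B (≢-sym z≢v))
             ; (inj₂ (z∈ , _)) (inj₂ (z′∈ , _)) → homogeneous S₁.maximal z∈ z′∈ })

        module _ {S₂ : Subset n} (S₂-max : Maximal _≁_ U S₂) (v∈S₂ : v ∈ S₂)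
                 (S₁∖B⊆S₂ : ∀ {z} → z ∈ S₁.set → z ∉ B → z ∈ S₂)
                 {w : Fin n} (w∈K₁ : w ∈ K₁.set) (w∈S₂ : w ∈ S₂) where

          w≢y : w ≢ y
          w≢y = ∈∉⇒≢ w∈S₂ (≁⇒∉ (dual D) S₂-max v∈S₂ (~-sym y~v))

          w≢c : w ≢ c
          w≢c = ∈∉⇒≢ w∈K₁ (≁⇒∉ D K₁.maximal K₁.centre y≁c)

          y~w : y ~ w
          y~w = homogeneous K₁.maximal K₁.centre w∈K₁ (≢-sym w≢y)

          c≁w : c ≁ w
          c≁w = homogeneous S₂-max (S₁∖B⊆S₂ S₁.centre c∉B) w∈S₂ (≢-sym w≢c)

          -- `w` is non-adjacent to `c`, a vertex of the clique `A`, and adjacent to `y`, a vertex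
          -- of the stable set `B`.
          w∉ : Outside U A B w
          w∉ = outside (within S₂-max w∈S₂) (≁⇒∉ D A-max c∈A c≁w) (≁⇒∉ (dual D) B-max y∈B y~w)

          -- Neighbours of `y` in `A` belong to the clique K₁, as does `w`. This is what
          -- `shadowed⇒neighbour` needs in the dual, to prepare for the dual `partner`.
          shadow : Shadow (dual D) (swap cis) y w
          shadow = flip w∉ , y~w , λ a∈A a≁w →
            ¬~⇒≁ D (∈∉⇒≢ a∈A y∉A) λ a~y → ≁⇒∉ D K₁.maximal (K₁.leaf a∈A a~y) a≁w w∈K₁

          module _ {y′ : Fin n} (y′∈B : y′ ∈ B) (¬common′ : ∀ {a} → a ∈ A → a ≁ y → ¬ a ≁ y′) where

            -- Otherwise some a in `A` is adjacent to neither `w` nor `y′`. By `shadow` it is not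
            -- adjacent to `y` either, so N(y) and N(y′) do not cover `A`.
            w~y′ : w ~ y′
            w~y′ = ¬~⇒≁ (dual D) (≢-sym (∈∉⇒≢ y′∈B (∉B w∉))) λ w≁y′ →
              let a , a∈A , a≁w , a≁y′ = common-neighbour (dual D) (swap cis) (flip w∉) (within B-max y′∈B)
                                           (λ y′∈A → disjoint y′∈A y′∈B) w≁y′
              in  ¬common′ a∈A (proj₂ (proj₂ shadow) a∈A a≁w) a≁y′

            c~y′ : c ~ y′
            c~y′ = ¬~⇒≁ (dual D) (≢-sym (∈∉⇒≢ y′∈B c∉B)) (¬common′ c∈A (≁-sym y≁c))

            -- K ∩ S₁ ⊆ S₂, so it can only be {w}; but y ∈ S₁ is adjacent to w.
            K∩S₁≡∅ : ∀ {K x} → Maximal _~_ U K → w ∈ K → y′ ∈ K → x ∈ K → x ∉ S₁.set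
            K∩S₁≡∅ K-max w∈K y′∈K x∈K x∈S₁ =
              exclusive (homogeneous K-max x∈K w∈K x≢w) (homogeneous S₂-max (S₁∖B⊆S₂ x∈S₁ x∉B) w∈S₂ x≢w)
              where
              x≢w = ∈∉⇒≢ x∈S₁ (≁⇒∉ (dual D) S₁.maximal (S₁.leaf y∈B y≁c) y~w)
              x≢y′ = ∈∉⇒≢ x∈S₁ (≁⇒∉ (dual D) S₁.maximal S₁.centre c~y′)
              x∉B = ≁⇒∉ (dual D) B-max y′∈B (homogeneous K-max y′∈K x∈K (≢-sym x≢y′))

            partner-absurd : ⊥
            partner-absurd =
              let K , K-max , w∈K , y′∈K = maximal-edge D (∈U w∉) (within B-max y′∈B) w~y′
                  x , x∈K , x∈S₁ = meet-K K-max S₁.maximal w∈K (∉A w∉)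
              in  K∩S₁≡∅ K-max w∈K y′∈K x∈K x∈S₁

          meeting-absurd : ⊥
          meeting-absurd =
            let u , u∉ , y≁u = shadowed⇒neighbour (dual D) (swap cis) y∈B shadow
                y′ , y′∈B , ¬common′ = partner (dual D) size (swap cis) y∈B u∉ y≁u
            in  partner-absurd y′∈B ¬common′

      impossible : ⊥
      impossible =
        let S₂ , S₂-max , ⊆S₂ = S₂-exists
            w , w∈K₁ , w∈S₂ = meet-K K₁.maximal S₂-max K₁.centre y∉A
        in  meeting-absurd S₂-max (⊆S₂ (inj₁ refl)) (λ z∈S₁ z∉B → ⊆S₂ (inj₂ (z∈S₁ , z∉B))) w∈K₁ w∈S₂

  covered-suc : Covered n (suc k)
  covered-suc D size cis x∉ =
    let c₀ , c₀∈A , c₀≁x , c₀≼x = lower-A D cis x∉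
        v , shadow@(v∉ , _ , v≼c₀) = lower-W D cis c₀∈A x∉ c₀≁x c₀≼x
        _ , u∉ , c₀~u = shadowed⇒neighbour D cis c₀∈A shadow
        c , c∈A , ¬common = partner D size cis c₀∈A u∉ c₀~u
        y , y∈B , y~v , _ = lower-A (dual D) (swap cis) (flip v∉)
    -- N(v) ∩ B lies in N(c₀), and `c` has no neighbour in N(c₀) ∩ B.
    in  Obstruction.impossible D size cis v∉ c∈A y∈B y~v (λ b∈B b~v → ¬common b∈B (v≼c₀ b∈B b~v))

covered : ∀ k → Covered n k
covered zero    D ()
covered (suc k) = covered-suc (covered k)

-- Edge simplicial graphs

ClosedNbr : Rel (Fin n) 0ℓ → Rel (Fin n) 0ℓ
ClosedNbr R x y = x ≡ y ⊎ R x y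

Simplicial : Rel (Fin n) 0ℓ → Fin n → Set
Simplicial R a = ∀ x y → ClosedNbr R a x → ClosedNbr R a y → x ≢ y → R x y

EdgeSimplicial : Rel (Fin n) 0ℓ → Set
EdgeSimplicial R = ∀ {x y} → R x y → ∃[ a ] (Simplicial R a × ClosedNbr R a x × ClosedNbr R a y)

simplicial? : {R : Rel (Fin n) 0ℓ} → Binary.Decidable R → Decidable (Simplicial R)
simplicial? R? a = all? λ x → all? λ y →
  (a ≟ x ⊎-dec R? a x) →-dec ((a ≟ y ⊎-dec R? a y) →-dec (¬? (x ≟ y) →-dec R? x y))

isolated⇒simplicial : {R : Rel (Fin n) 0ℓ} {v : Fin n} → ¬ ∃ (R v) → Simplicial R v
isolated⇒simplicial iso x y (inj₁ refl) (inj₁ refl) x≢y = contradiction refl x≢y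
isolated⇒simplicial iso x y (inj₂ Rvx) _ _ = contradiction (x , Rvx) iso
isolated⇒simplicial iso x y _ (inj₂ Rvy) _ = contradiction (y , Rvy) iso

Bisimplicial : Dichotomy n → Fin n → Set
Bisimplicial D v = Simplicial _~_ v × Simplicial _≁_ v
  where open Dichotomy D

module _ (D : Dichotomy n) where
  open Dichotomy D

  bisimplicial? : Decidable (Bisimplicial D)
  bisimplicial? v = simplicial? ~? v ×-dec simplicial? ≁? v

  -- If v is bisimplicial, N(v) is a clique and its complement is stable, so
  -- every non-neighbour of v is simplicial.
  bisimplicial⇒≁-simplicial : ∀ {v x} → Bisimplicial D v → v ≁ x → Simplicial _~_ x
  bisimplicial⇒≁-simplicial {v} {x} (simpl , cosimpl) v≁x y z x̂y x̂z y≢z = go x̂y x̂z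
    where
    v~nbr : ∀ {u} → x ~ u → v ~ u
    v~nbr {u} x~u = ¬~⇒≁ (dual D) (λ { refl → exclusive x~u (≁-sym v≁x) })
      λ v≁u → exclusive x~u (cosimpl x u (inj₂ v≁x) (inj₂ v≁u) (~⇒≢ D x~u))
    go : ClosedNbr _~_ x y → ClosedNbr _~_ x z → y ~ z
    go (inj₁ refl) (inj₁ refl) = contradiction refl y≢z
    go (inj₁ refl) (inj₂ x~z)  = x~z
    go (inj₂ x~y)  (inj₁ refl) = ~-sym x~y
    go (inj₂ x~y)  (inj₂ x~z)  = simpl y z (inj₂ (v~nbr x~y)) (inj₂ (v~nbr x~z)) y≢z

  -- The centre is `v` if both ends are in N[v], and otherwise an end not adjacent to `v`.
  bisimplicial⇒edgeSimplicial : ∀ {v} → Bisimplicial D v → EdgeSimplicial _~_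
  bisimplicial⇒edgeSimplicial {v} bi {x} {y} x~y = go (near x) (near y)
    where
    near : ∀ u → ClosedNbr _~_ v u ⊎ v ≁ u
    near u with v ≟ u
    ... | yes v≡u = inj₁ (inj₁ v≡u)
    ... | no  v≢u = [ inj₁ ∘ inj₂ , inj₂ ]′ (total v≢u)
    go : ClosedNbr _~_ v x ⊎ v ≁ x → ClosedNbr _~_ v y ⊎ v ≁ y →
         ∃[ a ] (Simplicial _~_ a × ClosedNbr _~_ a x × ClosedNbr _~_ a y)
    go (inj₁ v̂x) (inj₁ v̂y) = v , proj₁ bi , v̂x , v̂y
    go (inj₂ v≁x) _ = x , bisimplicial⇒≁-simplicial bi v≁x , inj₁ refl , inj₂ x~y
    go _ (inj₂ v≁y) = y , bisimplicial⇒≁-simplicial bi v≁y , inj₂ (~-sym x~y) , inj₁ refl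

  module _ (none : ¬ ∃ (Bisimplicial D)) (coedge : EdgeSimplicial _≁_) where

    -- A vertex adjacent to all others is isolated in the complement, hence simplicial there.
    simplicial⇒has-non-neighbour : ∀ {a} → Simplicial _~_ a → ∃[ z ] a ≁ z
    simplicial⇒has-non-neighbour {a} simpl with any? (≁? a)
    ... | yes found = found
    ... | no dom = contradiction (a , simpl , isolated⇒simplicial dom) none

    -- Suppose a ~ a′. A co-edge at `a` has a cosimplicial centre b, distinct from both and not
    -- adjacent to `a`. As N[a′] is a clique, b is not adjacent to `a′`, and cosimpliciality of b
    -- then gives a ≁ a′.
    simplicial-stable : ∀ {a a′} → Simplicial _~_ a → Simplicial _~_ a′ → a ≢ a′ → a ≁ a′
    simplicial-stable {a} {a′} simpl simpl′ a≢a′ = ¬~⇒≁ D a≢a′ λ a~a′ →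
      let z , a≁z = simplicial⇒has-non-neighbour simpl
          b , cosimpl , b̂a , _ = coedge a≁z
          b≢a : b ≢ a
          b≢a = λ b≡a → none (a , simpl , subst (Simplicial _≁_) b≡a cosimpl)
          b≢a′ : b ≢ a′
          b≢a′ = λ b≡a′ → none (a′ , simpl′ , subst (Simplicial _≁_) b≡a′ cosimpl)
          b≁a = [ (λ b≡a → contradiction b≡a b≢a) , id ]′ b̂a
          b≁a′ = ¬~⇒≁ D b≢a′ λ b~a′ →
            exclusive (simpl′ b a (inj₂ (~-sym b~a′)) (inj₂ (~-sym a~a′)) b≢a) b≁a
      in  exclusive a~a′ (cosimpl a a′ (inj₂ b≁a) (inj₂ b≁a′) a≢a′)

    -- Otherwise an edge and a co-edge at `x` have centres a and b, different from each other and
    -- from `x`, with a ~ x and b ≁ x. If a ~ b, then N[a] forces b ~ x; if a ≁ b, the dual argument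
    -- at b forces a ≁ x.
    simplicial-or-cosimplicial : EdgeSimplicial _~_ → ∀ x → Simplicial _~_ x ⊎ Simplicial _≁_ x
    simplicial-or-cosimplicial edge x with any? (~? x) | any? (≁? x)
    ... | no iso | _      = inj₁ (isolated⇒simplicial iso)
    ... | yes _  | no dom = inj₂ (isolated⇒simplicial dom)
    ... | yes (y , x~y) | yes (z , x≁z) with edge x~y | coedge x≁z
    ...   | a , simpl , âx , _ | b , cosimpl , b̂x , _ with a ≟ b | a ≟ x | b ≟ x
    ...     | yes refl | _ | _ = contradiction (a , simpl , cosimpl) none
    ...     | no _ | yes refl | _ = inj₁ simpl
    ...     | no _ | no _ | yes refl = inj₂ cosimpl
    ...     | no a≢b | no a≢x | no b≢x = contradiction (total a≢b)
      [ (λ a~b → exclusive (simpl b x (inj₂ a~b) âx b≢x) (strip b≢x b̂x))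
      , (λ a≁b → exclusive (strip a≢x âx) (cosimpl a x (inj₂ (≁-sym a≁b)) b̂x a≢x)) ]′
      where
      strip : ∀ {P : Set} {u v : Fin n} → u ≢ v → u ≡ v ⊎ P → P
      strip u≢v = [ (λ u≡v → contradiction u≡v u≢v) , id ]′

-- Split graphs

record Split (D : Dichotomy n) : Set where
  open Dichotomy D
  field
    C      : Subset n
    clique : Homogeneous _~_ C
    stable : Homogeneous _≁_ (∁ C)

-- Both sides are named, so that passing to the dual merely exchanges them.
record SplitPartition (D : Dichotomy n) (C S : Subset n) : Set where
  open Dichotomy D
  field
    clique : Homogeneous _~_ C
    stable : Homogeneous _≁_ S
    cover  : ∀ x → x ∈ C ⊎ x ∈ S

swap-partition : ∀ {D : Dichotomy n} {C S} → SplitPartition D C S → SplitPartition (dual D) S C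
swap-partition part = record { clique = stable ; stable = clique ; cover = λ x → [ inj₂ , inj₁ ]′ (cover x) }
  where open SplitPartition part

module _ (D : Dichotomy n) where
  open Dichotomy D

  bisimplicial⇒split : ∀ {v} → Bisimplicial D v → Split D
  bisimplicial⇒split {v} (simpl , cosimpl) = record
    -- The open neighbourhood: `v` itself goes to the stable side.
    { C = comprehension (~? v)
    ; clique = λ x∈ y∈ → simpl _ _ (inj₂ (∈-comprehension⁻ (~? v) x∈)) (inj₂ (∈-comprehension⁻ (~? v) y∈))
    ; stable = λ x∈ y∈ → cosimpl _ _ (far x∈) (far y∈)
    }
    where
    far : ∀ {x} → x ∈ ∁ (comprehension (~? v)) → ClosedNbr _≁_ v x
    far {x} x∈ with v ≟ x
    ... | yes v≡x = inj₁ v≡x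
    ... | no  v≢x = inj₂ (¬~⇒≁ D v≢x (x∈∁p⇒x∉p x∈ ∘ ∈-comprehension⁺ (~? v)))

  edgeSimplicial⇒split : EdgeSimplicial _~_ → EdgeSimplicial _≁_ → Split D
  edgeSimplicial⇒split edge coedge with any? (bisimplicial? D)
  ... | yes (_ , bi) = bisimplicial⇒split bi
  ... | no none = record
    { C = comprehension cosimplicial?
    ; clique = λ x∈ y∈ → simplicial-stable (dual D) (λ (v , co , simpl) → none (v , simpl , co)) edge
                           (∈-comprehension⁻ cosimplicial? x∈) (∈-comprehension⁻ cosimplicial? y∈)
    ; stable = λ x∈ y∈ → simplicial-stable D none coedge (simpl x∈) (simpl y∈)
    }
    where
    cosimplicial? : Decidable (Simplicial _≁_)
    cosimplicial? = simplicial? ≁?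
    simpl : ∀ {x} → x ∈ ∁ (comprehension cosimplicial?) → Simplicial _~_ x
    simpl {x} x∈ = [ id , (λ co → contradiction (∈-comprehension⁺ cosimplicial? co) (x∈∁p⇒x∉p x∈)) ]′
      (simplicial-or-cosimplicial D none coedge edge x)

  almostCIS⇒split : ∀ {A B} → AlmostCIS D ⊤ A B → Split D
  almostCIS⇒split {A} {B} cis = record
    { C = A ; clique = homogeneous A-max
    ; stable = λ x∈ y∈ → homogeneous B-max (∁A⊆B x∈) (∁A⊆B y∈) }
    where
    open AlmostCIS cis
    ∁A⊆B : ∁ A ⊆ B
    ∁A⊆B {x} x∈ with x ∈? B
    ... | yes x∈B = x∈B
    -- `≤-refl` fixes the bound at one more than the size of `⊤`.
    ... | no  x∉B = contradiction (outside ∈⊤ (x∈∁p⇒x∉p x∈) x∉B) (covered _ D ≤-refl cis)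

  module _ {C S : Subset n} (part : SplitPartition D C S) where
    open SplitPartition part

    -- All neighbours of `x` lie in `C` and all non-neighbours in `S`.
    complete⇒bisimplicial : ∀ {x} → x ∈ S → (∀ {y} → y ∈ C → x ≢ y → x ~ y) → Bisimplicial D x
    complete⇒bisimplicial {x} x∈S x~C = simpl , λ _ _ x̂y x̂z → stable (inS x̂y) (inS x̂z)
      where
      inS : ∀ {y} → ClosedNbr _≁_ x y → y ∈ S
      inS (inj₁ refl) = x∈S
      inS {y} (inj₂ x≁y) = [ (λ y∈C → contradiction x≁y (exclusive (x~C y∈C (~⇒≢ (dual D) x≁y)))) , id ]′ (cover y)
      inC : ∀ {y} → x ~ y → y ∈ C
      inC {y} x~y = [ id , (λ y∈S → contradiction (stable x∈S y∈S (~⇒≢ D x~y)) (exclusive x~y)) ]′ (cover y)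
      simpl : Simplicial _~_ x
      simpl y z (inj₁ refl) (inj₁ refl) y≢z = contradiction refl y≢z
      simpl y z (inj₁ refl) (inj₂ x~z) _ = x~z
      simpl y z (inj₂ x~y) (inj₁ refl) _ = ~-sym x~y
      simpl y z (inj₂ x~y) (inj₂ x~z) = clique (inC x~y) (inC x~z)

    clique-maximal : ¬ ∃ (Bisimplicial D) → Maximal _~_ ⊤ C
    clique-maximal none = record
      { within = ⊆⊤ ; homogeneous = clique
      ; closed = λ {x} _ x~C → [ id , (λ x∈S → contradiction (x , complete⇒bisimplicial x∈S x~C) none) ]′ (cover x) }

    -- If x is in both `K` and `S`, it is not in `T`, so some z in `T` is adjacent to it, and z is
    -- in `C`. As z is not in `K`, some k in `K` is not adjacent to z, and k is in `S`. Then x and k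
    -- are distinct members of both the clique `K` and the stable set `S`.
    disjoint⇒⊆clique : ∀ {K T} → Maximal _~_ ⊤ K → Maximal _≁_ ⊤ T → ¬ (∃[ v ] (v ∈ K × v ∈ T)) → K ⊆ C
    disjoint⇒⊆clique K-max T-max disj {x} x∈K = [ id , (λ x∈S → ⊥-elim (absurd x∈S)) ]′ (cover x)
      where
      absurd : x ∈ S → ⊥
      absurd x∈S =
        let z , z∈T , x~z = outside⇒≁ (dual D) T-max ∈⊤ (λ x∈T → disj (x , x∈K , x∈T))
            z∉S = λ z∈S → exclusive x~z (stable x∈S z∈S (~⇒≢ D x~z))
            z∈C = [ id , (λ z∈S → contradiction z∈S z∉S) ]′ (cover z)
            k , k∈K , z≁k = outside⇒≁ D K-max ∈⊤ (λ z∈K → disj (z , z∈K , z∈T))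
            k∉C = λ k∈C → exclusive (clique z∈C k∈C (~⇒≢ (dual D) z≁k)) z≁k
            k∈S = [ (λ k∈C → contradiction k∈C k∉C) , id ]′ (cover k)
            x≢k : x ≢ k
            x≢k = λ x≡k → exclusive x~z (≁-sym (subst (z ≁_) (sym x≡k) z≁k))
        in  exclusive (homogeneous K-max x∈K k∈K x≢k) (stable x∈S k∈S x≢k)

    disjoint⇒≡clique : ∀ {K T} → Maximal _~_ ⊤ K → Maximal _≁_ ⊤ T → ¬ (∃[ v ] (v ∈ K × v ∈ T)) → K ≡ C
    disjoint⇒≡clique K-max T-max disj = ⊆-antisym K⊆C
      (λ x∈C → closed K-max ∈⊤ (λ y∈K → clique x∈C (K⊆C y∈K)))
      where K⊆C = disjoint⇒⊆clique K-max T-max disj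

-- Graphs as dichotomies

Adjacent : Graph n → Rel (Fin n) 0ℓ
Adjacent G x y = adj G x y ≡ true

edgeSimplicial⁺ : (G : Graph n) → EdgeSimplicial (Adjacent G) → IsEdgeSimplicial G
edgeSimplicial⁻ : (G : Graph n) → IsEdgeSimplicial G → EdgeSimplicial (Adjacent G)

private
  ∈N⁺ : ∀ (G : Graph n) {v x} → ClosedNbr (Adjacent G) v x → x ∈ N[_] G v
  ∈N⁺ G {v} {x} v̂x = ∈-tabulate⁺ (go v̂x)
    where
    go : ClosedNbr (Adjacent G) v x → adj G v x ∨ ⌊ x ≟ v ⌋ ≡ true
    go (inj₂ eq) rewrite eq = refl
    go (inj₁ refl) with v ≟ v
    ... | yes _   = ∨-zeroʳ _
    ... | no  v≢v = contradiction refl v≢v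

  ∈N⁻ : ∀ (G : Graph n) {v x} → x ∈ N[_] G v → ClosedNbr (Adjacent G) v x
  ∈N⁻ G {v} {x} x∈ with x ≟ v | ∈-tabulate⁻ {f = λ u → adj G v u ∨ ⌊ u ≟ v ⌋} x∈
  ... | yes x≡v | _  = inj₁ (sym x≡v)
  ... | no _    | eq = inj₂ (trans (sym (∨-identityʳ _)) eq)

edgeSimplicial⁺ G edge u v u~v =
  let a , simpl , âu , âv = edge u~v
  in  N[_] G a , ((λ x y x∈ y∈ → simpl x y (∈N⁻ G x∈) (∈N⁻ G y∈)) , a , refl) , ∈N⁺ G âu , ∈N⁺ G âv

edgeSimplicial⁻ G edge {x} {y} x~y with edge x y x~y
... | _ , (clique , a , refl) , x∈ , y∈ =
  a , (λ u v âu âv → clique u v (∈N⁺ G âu) (∈N⁺ G âv)) , ∈N⁻ G x∈ , ∈N⁻ G y∈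

module _ (G : Graph n) where

  co-adjacent⁺ : ∀ {x y} → x ≢ y → adj G x y ≡ false → Adjacent (complement G) x y
  co-adjacent⁺ {x} {y} x≢y eq rewrite eq with x ≟ y
  ... | yes x≡y = contradiction x≡y x≢y
  ... | no  _   = refl

  co-adjacent⁻ : ∀ {x y} → Adjacent (complement G) x y → adj G x y ≡ false
  co-adjacent⁻ {x} {y} eq with adj G x y
  co-adjacent⁻ {x} {y} ()  | true
  co-adjacent⁻ {x} {y} eq  | false = refl

  private
    irrefl : ∀ (H : Graph n) {x} → ¬ Adjacent H x x
    irrefl H {x} eq with trans (sym eq) (adj-irrefl H x)
    ... | ()

  -- `_≁_` is adjacency in the complement and not `adj G x y ≡ false`, which would hold on the
  -- diagonal.
  dichotomy : Dichotomy n
  dichotomy = record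
    { _~_ = Adjacent G ; _≁_ = Adjacent (complement G)
    ; ~? = λ x y → adj G x y ≟ᵇ true ; ≁? = λ x y → adj (complement G) x y ≟ᵇ true
    ; ~-sym = λ {x} {y} eq → trans (adj-sym G y x) eq
    ; ≁-sym = λ {x} {y} eq → trans (adj-sym (complement G) y x) eq
    ; ~-irrefl = irrefl G ; ≁-irrefl = irrefl (complement G)
    ; exclusive = λ x~y x≁y → contradiction (trans (sym x~y) (co-adjacent⁻ x≁y)) λ ()
    ; total = tot
    }
    where
    tot : ∀ {x y} → x ≢ y → Adjacent G x y ⊎ Adjacent (complement G) x y
    tot {x} {y} x≢y with adj G x y in eq
    ... | true  = inj₁ refl
    ... | false = inj₂ (subst (λ b → not b ∧ not ⌊ x ≟ y ⌋ ≡ true) eq (co-adjacent⁺ x≢y eq))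

  open Dichotomy dichotomy

  stable⁺ : ∀ {S} → Homogeneous _≁_ S → IsStable G S
  stable⁺ hom u v u∈S v∈S with u ≟ v
  ... | yes refl = adj-irrefl G u
  ... | no  u≢v  = co-adjacent⁻ (hom u∈S v∈S u≢v)

  stable⁻ : ∀ {S} → IsStable G S → Homogeneous _≁_ S
  stable⁻ stable x∈S y∈S x≢y = co-adjacent⁺ x≢y (stable _ _ x∈S y∈S)

  maximalClique⁺ : ∀ {K} → Maximal _~_ ⊤ K → IsMaximalClique G K
  maximalClique⁺ K-max = (λ _ _ → homogeneous K-max) ,
    λ D D-clique K⊆D x∈D → closed K-max ∈⊤ (λ y∈K → D-clique _ _ x∈D (K⊆D y∈K))

  maximalStable⁺ : ∀ {S} → Maximal _≁_ ⊤ S → IsMaximalStable G S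
  maximalStable⁺ S-max = stable⁺ (homogeneous S-max) ,
    λ D D-stable S⊆D x∈D → closed S-max ∈⊤ (λ y∈S → stable⁻ D-stable x∈D (S⊆D y∈S))

  maximalClique⁻ : ∀ {K} → IsMaximalClique G K → Maximal _~_ ⊤ K
  maximalClique⁻ (clique , max) = record
    { within = ⊆⊤ ; homogeneous = clique _ _
    ; closed = λ {x} _ x~K →
        -- Any clique containing the given one and `x` serves for `max`.
        let K′ , K′-max , ⊆K′ = extend ~? ~-sym (adjoin? _ x) (λ _ → ∈⊤) (adjoin-homogeneous ~-sym (clique _ _) x~K)
        in  max K′ (λ _ _ → homogeneous K′-max) (⊆K′ ∘ inj₁) (⊆K′ (inj₂ refl)) }

  maximalStable⁻ : ∀ {S} → IsMaximalStable G S → Maximal _≁_ ⊤ S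
  maximalStable⁻ (stable , max) = record
    { within = ⊆⊤ ; homogeneous = stable⁻ stable
    ; closed = λ {x} _ x≁S →
        let S′ , S′-max , ⊆S′ = extend ≁? ≁-sym (adjoin? _ x) (λ _ → ∈⊤) (adjoin-homogeneous ≁-sym (stable⁻ stable) x≁S)
        in  max S′ (stable⁺ (homogeneous S′-max)) (⊆S′ ∘ inj₁) (⊆S′ (inj₂ refl)) }

  split⁺ : Split dichotomy → IsSplit G
  split⁺ split = C , ∁ C , (λ _ _ → clique) , stable⁺ stable , (λ _ → x∈p⇒x∉∁p) , cover
    where
    open Split split
    cover : ∀ v → v ∈ C ⊎ v ∈ ∁ C
    cover v with v ∈? C
    ... | yes v∈C = inj₁ v∈C
    ... | no  v∉C = inj₂ (x∉p⇒x∈∁p v∉C)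

  almostCIS⁻ : ((A , B , _) : IsAlmostCIS G) → AlmostCIS dichotomy ⊤ A B
  almostCIS⁻ (A , B , A-max , B-max , disj , unique) = record
    { A-max = maximalClique⁻ A-max ; B-max = maximalStable⁻ B-max
    ; disjoint = λ x∈A x∈B → disj (_ , x∈A , x∈B)
    ; meet-K = λ K-max S-max x∈K x∉A → meet K-max S-max λ { (refl , _) → x∉A x∈K }
    ; meet-S = λ K-max S-max x∈S x∉B → meet K-max S-max λ { (_ , refl) → x∉B x∈S }
    }
    where
    meet : ∀ {K S} → Maximal _~_ ⊤ K → Maximal _≁_ ⊤ S → ¬ (K ≡ A × S ≡ B) → ∃[ y ] (y ∈ K × y ∈ S)
    meet {K} {S} K-max S-max ≢AB with any? (λ y → y ∈? K ×-dec y ∈? S)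
    ... | yes found = found
    ... | no  none  = contradiction (unique K S (maximalClique⁺ K-max) (maximalStable⁺ S-max) none) ≢AB

  split⇒almostCIS⊎capEdgeSimplicial : IsSplit G → IsAlmostCIS G ⊎ IsCapEdgeSimplicial G
  split⇒almostCIS⊎capEdgeSimplicial (C , S , clique , stable , disj , cover) with any? (bisimplicial? dichotomy)
  ... | yes (v , bi@(simpl , cosimpl)) = inj₂
    ( edgeSimplicial⁺ G (bisimplicial⇒edgeSimplicial dichotomy bi)
    , edgeSimplicial⁺ (complement G) (bisimplicial⇒edgeSimplicial (dual dichotomy) (cosimpl , simpl)))
  ... | no none = inj₁
    ( C , S
    , maximalClique⁺ (clique-maximal dichotomy part none)
    , maximalStable⁺ (clique-maximal (dual dichotomy) (swap-partition part) (λ (v , co , simpl) → none (v , simpl , co)))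
    , (λ (v , v∈C , v∈S) → disj v v∈C v∈S)
    , λ K T K-max T-max K∩T≡∅ →
        disjoint⇒≡clique dichotomy part (maximalClique⁻ K-max) (maximalStable⁻ T-max) K∩T≡∅ ,
        disjoint⇒≡clique (dual dichotomy) (swap-partition part) (maximalStable⁻ T-max) (maximalClique⁻ K-max)
          (λ (v , v∈T , v∈K) → K∩T≡∅ (v , v∈K , v∈T)))
    where
    part : SplitPartition dichotomy C S
    part = record { clique = clique _ _ ; stable = stable⁻ stable ; cover = cover }

theorem28 : ∀ (n : ℕ) (G : Graph n) →
    (IsSplit G → IsAlmostCIS G ⊎ IsCapEdgeSimplicial G) ×
    (IsAlmostCIS G ⊎ IsCapEdgeSimplicial G → IsSplit G)
theorem28 n G = split⇒almostCIS⊎capEdgeSimplicial G ,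
  [ (λ cis → split⁺ G (almostCIS⇒split (dichotomy G) (almostCIS⁻ G cis)))
  , (λ (edge , coedge) → split⁺ G (edgeSimplicial⇒split (dichotomy G)
      (edgeSimplicial⁻ G edge) (edgeSimplicial⁻ (complement G) coedge))) ]′
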